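{- Let $S\neq\mathbb Z_{\ge 0}$ be a numerical semigroup, let $m\in S$ be nonzero, and let $c_1<\dots<c_n$ be the elements of $\mathbb Z_{\ge 0}\setminus S$. Then for all integers $k\ge 1$ and $1\le p<m$ $$\prod_{i=1}^n\ \prod_{J\subset T_i\setminus\{0\},\ |J|=p-1}\left(1+\frac{\sum_{j=1}^k\binom{k}{j}c_i^{k-j}m^j}{\sum_{a\in J}a^k+c_i^k}\right)=\frac{\prod_{I\subset S^{(m)}\setminus\{0\},\ |I|=p}\ \sum_{a\in I}a^k}{\prod_{I\subset I_m\setminus\{0\},\ |I|=p}\ \sum_{a\in I}a^k}.$$ In particular, for $p=m-1$, $$\prod_{i=1}^n\left(1+\frac{\sum_{j=1}^k\binom{k}{j}c_i^{k-j}m^j}{\sum_{a\in T_i}a^k+c_i^k}\right)=\frac{\sum_{a\in S^{(m)}}a^k}{\sum_{a\in I_m}a^k},$$ and for $p=1$, $$\prod_{i=1}^n\left(1+\frac{m}{c_i}\right)=\frac{\prod_{a\in S^{(m)}\setminus\{0\}}a}{(m-1)!}.$$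
   Context: A numerical semigroup is a set $S\subset\mathbb Z_{\ge 0}$ that contains $0$, is closed under addition and has finite complement in $\mathbb Z_{\ge 0}$. For a numerical semigroup $S$ and a nonzero $m\in S$, the Apéry set is $S^{(m)}:=\{s\in S: s-m\notin S\}$; it has exactly $m$ elements, one in each residue class mod $m$, and contains $0$. Put $I_m:=\{0,1,\dots,m-1\}$. With $\mathbb Z_{\ge 0}\setminus S=\{c_1<\dots<c_n\}$, let $S_0:=\mathbb Z_{\ge 0}$ and $S_i:=\mathbb Z_{\ge 0}\setminus\{c_1,\dots,c_i\}$ for $i=1,\dots,n$ (so $S_n=S$); each $S_i$ is a numerical semigroup containing $m$. For $i=1,\dots,n$ put $T_i:=S_i^{(m)}\setminus\{c_i+m\}=S_{i-1}^{(m)}\setminus\{c_i\}$, a set of $m-1$ elements containing $0$. Empty sums equal $0$. -}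

module Defs where

open import Level using (0ℓ)
open import Data.Empty using (⊥-elim)
open import Data.Fin using (Fin; toℕ)
import Data.Fin as Fin
import Data.Fin.Properties as Fin
open import Data.Integer using (+_)
open import Data.List using (List; []; _∷_; _++_; map; filter; foldr; upTo; tabulate)
open import Data.List.Extrema.Nat using (max; xs≤max)
open import Data.List.Membership.Propositional using (_∈_)
open import Data.List.Membership.Propositional.Properties
  using (∈-filter⁺; ∈-filter⁻; ∈-upTo⁺; ∈-tabulate⁺)
open import Data.List.Relation.Unary.All using (All; []; _∷_)
import Data.List.Relation.Unary.All as All
import Data.List.Relation.Unary.All.Properties as All
open import Data.Nat
open import Data.Nat.Combinatorics using (_C_)
open import Data.Nat.ListAction using (sum; product)
open import Data.Nat.ListAction.Properties using (product≢0)
open import Data.Nat.Properties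
open import Data.Product using (∃; _×_; _,_; proj₁; proj₂)
open import Data.Rational as ℚ using (ℚ; 1ℚ)
open import Function.Base using (_∘_)
open import Function.Bundles using (_⇔_; mk⇔)
open import Relation.Binary.PropositionalEquality
open import Relation.Nullary using (¬_; Dec; yes; no; ¬?; _×-dec_; _→-dec_; contradiction)
open import Relation.Unary using (Pred; Decidable)

-- Membership is decidable, so a list containing every gap is the
-- constructive content of "the complement is finite".
record NumericalSemigroup : Set₁ where
  field
    Mem               : Pred ℕ 0ℓ
    mem?              : Decidable Mem
    0-mem             : Mem 0
    +-closed          : ∀ {x y} → Mem x → Mem y → Mem (x + y)
    finite-complement : ∃ λ (gaps : List ℕ) → ∀ {x} → ¬ Mem x → x ∈ gaps

open NumericalSemigroup public

infix 4 _∈ₛ_ _∉ₛ_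

_∈ₛ_ _∉ₛ_ : ℕ → NumericalSemigroup → Set
x ∈ₛ S = Mem S x
x ∉ₛ S = ¬ (x ∈ₛ S)

-- s ∈ S and s − m ∉ S, where s − m is an integer (hence not in S if negative).
IsApéry : NumericalSemigroup → ℕ → Pred ℕ 0ℓ
IsApéry S m s = s ∈ₛ S × ¬ (m ≤ s × s ∸ m ∈ₛ S)

isApéry? : ∀ S m → Decidable (IsApéry S m)
isApéry? S m s = mem? S s ×-dec ¬? ((m ≤? s) ×-dec mem? S (s ∸ m))

-- Finite subsets of ℕ are given by the increasing lists of their elements.
-- An Apéry element is at most m plus the largest gap, see ∈-apéry.
apéry : NumericalSemigroup → ℕ → List ℕ
apéry S m = filter (isApéry? S m) (upTo (suc (m + max 0 (proj₁ (finite-complement S)))))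

∈-apéry : ∀ S m s → s ∈ apéry S m ⇔ IsApéry S m s
∈-apéry S m s = mk⇔ (λ p → proj₂ (∈-filter⁻ (isApéry? S m) {xs = upTo _} p))
                    (λ p → ∈-filter⁺ (isApéry? S m) (∈-upTo⁺ (s≤s (bound p))) p)
  where
  gaps = proj₁ (finite-complement S)
  bound : IsApéry S m s → s ≤ m + max 0 gaps
  bound (_ , s-m∉S) with m ≤? s
  ... | no m≰s  = ≤-trans (<⇒≤ (≰⇒> m≰s)) (m≤m+n m _)
  ... | yes m≤s = subst (_≤ m + max 0 gaps) (m+[n∸m]≡n m≤s)
    (+-monoʳ-≤ m (All.lookup (xs≤max 0 gaps)
      (proj₂ (finite-complement S) (λ q → s-m∉S (m≤s , q)))))

-- c enumerates ℕ ∖ S increasingly; c i for i : Fin n is c_{i+1} in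
-- one-based numbering.
record IsGapSequence (S : NumericalSemigroup) {n} (c : Fin n → ℕ) : Set where
  field
    increasing : ∀ {i j} → i Fin.< j → c i < c j
    gap        : ∀ i → c i ∉ₛ S
    exhaustive : ∀ {x} → x ∉ₛ S → ∃ λ i → c i ≡ x

  gap≢0 : ∀ i → NonZero (c i)
  gap≢0 i = ≢-nonZero (λ ci≡0 → gap i (subst (Mem S) (sym ci≡0) (0-mem S)))

open IsGapSequence public

module _ {S : NumericalSemigroup} {n} {c : Fin n → ℕ} (g : IsGapSequence S c) where

  -- S_i = ℕ ∖ {c_1, …, c_i}
  truncation : ℕ → NumericalSemigroup
  truncation i = record
    { Mem               = λ x → ∀ j → toℕ j < i → x ≢ c j
    ; mem?              = λ x → Fin.all? (λ j → (toℕ j <? i) →-dec ¬? (x ≟ c j))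
    ; 0-mem             = λ j _ 0≡cj → gap g j (subst (Mem S) 0≡cj (0-mem S))
    ; +-closed          = closed
    ; finite-complement = tabulate c , covered
    }
    where
    M : Pred ℕ 0ℓ
    M x = ∀ j → toℕ j < i → x ≢ c j

    not-small : ∀ {x j} → M x → toℕ j < i → x ≤ c j → ¬ ¬ (x ∈ₛ S)
    not-small {x} {j} x∈ j<i x≤cj x∉S with exhaustive g x∉S
    ... | l , refl with toℕ l <? i
    ...   | yes l<i = x∈ l l<i refl
    ...   | no  l≮i = <⇒≱ (increasing g (<-≤-trans j<i (≮⇒≥ l≮i))) x≤cj

    closed : ∀ {x y} → M x → M y → M (x + y)
    closed {x} {y} x∈ y∈ j j<i x+y≡cj =
      not-small x∈ j<i (subst (x ≤_) x+y≡cj (m≤m+n x y)) λ x∈S →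
      not-small y∈ j<i (subst (y ≤_) x+y≡cj (m≤n+m y x)) λ y∈S →
      gap g j (subst (Mem S) x+y≡cj (+-closed S x∈S y∈S))

    covered : ∀ {x} → ¬ M x → x ∈ tabulate c
    covered {x} x∉ with Fin.any? (λ j → x ≟ c j)
    ... | yes (j , refl) = ∈-tabulate⁺ j
    ... | no ¬∃          = ⊥-elim (x∉ (λ j _ x≡cj → ¬∃ (j , x≡cj)))

  -- T_i = S_i^{(m)} ∖ {c_i + m}; the semigroup S_i omits c_i itself,
  -- whence the suc for the zero-based index i.
  T : ℕ → Fin n → List ℕ
  T m i = filter (λ x → ¬? (x ≟ c i + m)) (apéry (truncation (suc (toℕ i))) m)

infix 8 _∖0

_∖0 : List ℕ → List ℕ
xs ∖0 = filter (λ x → ¬? (x ≟ 0)) xs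

-- For xs without repetitions: its subsets with exactly r elements, each once.
subsetsOfSize : ∀ {A : Set} → ℕ → List A → List (List A)
subsetsOfSize zero    _        = [] ∷ []
subsetsOfSize (suc r) []       = []
subsetsOfSize (suc r) (x ∷ xs) = map (x ∷_) (subsetsOfSize r xs) ++ subsetsOfSize (suc r) xs

powerSum : ℕ → List ℕ → ℕ
powerSum k xs = sum (map (_^ k) xs)

-- ∑_{j=1}^{k} (k choose j) c^{k−j} m^j
binomialTail : ℕ → ℕ → ℕ → ℕ
binomialTail k c m = sum (map (λ j → (k C j) * c ^ (k ∸ j) * m ^ j) (map suc (upTo k)))

∏ : ∀ {A : Set} → List A → (A → ℚ) → ℚ
∏ xs f = foldr ℚ._*_ 1ℚ (map f xs)

infix 5 ∏
syntax ∏ xs (λ x → e) = ∏[ x ∈ xs ] e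

infix 7 _/_⟨_⟩

_/_⟨_⟩ : (a b : ℕ) → .(NonZero b) → ℚ
a / b ⟨ b≢0 ⟩ = ℚ._/_ (+ a) b {{b≢0}}

powerSum+^≢0 : ∀ k J c → NonZero c → NonZero (powerSum k J + c ^ k)
powerSum+^≢0 k J c c≢0 =
  >-nonZero (≤-trans (m^n>0 c {{c≢0}} k) (m≤n+m (c ^ k) (powerSum k J)))

private
  powerSums≢0 : ∀ k r xs → All NonZero xs →
                All NonZero (map (powerSum k) (subsetsOfSize (suc r) xs))
  powerSums≢0 k r []       []           = []
  powerSums≢0 k r (x ∷ xs) (x≢0 ∷ xs≢0) =
    All.map⁺ (All.++⁺ (All.map⁺ (All.universal head≢0 (subsetsOfSize r xs)))
                      (All.map⁻ (powerSums≢0 k r xs xs≢0)))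
    where
    head≢0 : ∀ J → NonZero (powerSum k (x ∷ J))
    head≢0 J = >-nonZero (≤-trans (m^n>0 x {{x≢0}} k) (m≤m+n (x ^ k) (powerSum k J)))

∏powerSum≢0 : ∀ k {p} xs → 1 ≤ p →
              NonZero (product (map (powerSum k) (subsetsOfSize p (xs ∖0))))
∏powerSum≢0 k {suc p} xs _ =
  product≢0 (powerSums≢0 k p (xs ∖0) (All.map ≢-nonZero (All.all-filter _ xs)))

powerSum-upTo≢0 : ∀ k {m} → 2 ≤ m → NonZero (powerSum k (upTo m))
powerSum-upTo≢0 k {suc (suc m)} _ = >-nonZero
  (≤-trans (m^n>0 1 k) (≤-trans (m≤m+n (1 ^ k) _) (m≤n+m _ (0 ^ k))))
powerSum-upTo≢0 k {suc zero} (s≤s ())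

proper⇒2≤m : ∀ S {m} → ¬ (∀ x → x ∈ₛ S) → m ∈ₛ S → m ≢ 0 → 2 ≤ m
proper⇒2≤m S {zero}        _   _   m≢0 = contradiction refl m≢0
proper⇒2≤m S {suc zero}    S≢ℕ 1∈S _   = contradiction all S≢ℕ
  where
  all : ∀ x → x ∈ₛ S
  all zero    = 0-mem S
  all (suc x) = +-closed S 1∈S (all x)
proper⇒2≤m S {suc (suc m)} _   _   _   = s≤s (s≤s z≤n)

{-# OPTIONS --safe #-}

-- Passing from S_{i-1} to S_i changes the Apéry set in one element only:
-- c_i is replaced by c_i + m.  For a function F of finite sets, the product
-- of the ratios F(S_i^{(m)}) / F(S_{i-1}^{(m)}) therefore telescopes to
-- F(S^{(m)}) / F(I_m).  The three identities are the cases
-- F(X) = ∏_{I ⊂ X∖0, |I| = p} ∑_{a ∈ I} a^k, F(X) = ∑_{a ∈ X} a^k and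
-- F(X) = ∏_{a ∈ X∖0} a, and the ratios come from the binomial theorem.

module Submission where

open import Defs
import Algebra.Properties.CommutativeSemiring.Binomial as Binomial
import Algebra.Properties.CommutativeSemigroup as CommutativeSemigroupProperties
import Algebra.Definitions.RawSemiring as RawSemiring
open import Algebra.Bundles using (CommutativeMonoid; CommutativeSemiring)
open import Data.Fin using (Fin; toℕ)
import Data.Fin as Fin
import Data.Fin.Properties as Fin
import Data.Integer as ℤ
import Data.Integer.Properties as ℤ
open import Data.List using (List; []; _∷_; _++_; [_]; map; upTo; applyUpTo; tabulate; allFin)
open import Data.List.Membership.Propositional using (_∈_)
open import Data.List.Membership.Propositional.Properties using (∈-filter⁺; ∈-filter⁻; ∈-upTo⁺; ∈-upTo⁻)
open import Data.List.Membership.Propositional.Properties.WithK using (unique∧set⇒bag)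
open import Data.List.Properties using (map-++; map-∘; map-cong; map-upTo; map-applyUpTo; applyUpTo-∷ʳ; filter-accept; filter-all)
open import Data.List.Relation.Binary.BagAndSetEquality using (∼bag⇒↭)
open import Data.List.Relation.Binary.Permutation.Propositional using (_↭_; prep; swap)
import Data.List.Relation.Binary.Permutation.Propositional as ↭
open import Data.List.Relation.Binary.Permutation.Propositional.Properties using (map⁺; filter-↭)
import Data.List.Relation.Unary.All as All
import Data.List.Relation.Unary.All.Properties as All
open import Data.List.Relation.Unary.Any using (here; there)
open import Data.List.Relation.Unary.AllPairs using (_∷_)
open import Data.List.Relation.Unary.Unique.Propositional using (Unique)
import Data.List.Relation.Unary.Unique.Propositional.Properties as Unique
open import Data.Nat
open import Data.Nat.Combinatorics using (_C_)
open import Data.Nat.ListAction using (sum; product)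
open import Data.Nat.ListAction.Properties using (product-++; product-↭; sum-↭)
open import Data.Nat.Properties
open import Data.Product using (_×_; _,_; proj₁; proj₂)
open import Data.Rational as ℚ using (ℚ; 1ℚ; fromℚᵘ; toℚᵘ)
import Data.Rational.Properties as ℚ
open import Data.Rational.Unnormalised as ℚᵘ using (mkℚᵘ; *≡*)
import Data.Rational.Unnormalised.Properties as ℚᵘ
open import Data.Sum using (inj₁; inj₂)
open import Function.Base using (_∘_; id)
open import Function.Bundles using (_⇔_; mk⇔; module Equivalence)
open import Relation.Binary.PropositionalEquality using (_≡_; _≢_; refl; sym; trans; cong; cong₂; subst; module ≡-Reasoning)
open import Relation.Nullary using (¬_; yes; no; ¬?; contradiction)

open Equivalence using (to; from)

private
  module ℕ-* = CommutativeSemigroupProperties *-commutativeSemigroup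
  module ℚ-* = CommutativeSemigroupProperties
    (CommutativeMonoid.commutativeSemigroup ℚ.*-1-commutativeMonoid)

-- Rational numbers with natural numerator and denominator

-- Follows from `toℚᵘ` being injective and homomorphic and inverting `fromℚᵘ` up to equivalence.
-- Identities between fractions thereby become cross-multiplications of integers, with no common
-- divisors to track.
fromℚᵘ-homo-+ : ∀ p q → fromℚᵘ (p ℚᵘ.+ q) ≡ fromℚᵘ p ℚ.+ fromℚᵘ q
fromℚᵘ-homo-+ p q = ℚ.toℚᵘ-injective (begin-equality
  toℚᵘ (fromℚᵘ (p ℚᵘ.+ q))                   ≃⟨ ℚ.toℚᵘ-fromℚᵘ (p ℚᵘ.+ q) ⟩
  p ℚᵘ.+ q                                   ≃⟨ ℚᵘ.+-cong (ℚ.toℚᵘ-fromℚᵘ p) (ℚ.toℚᵘ-fromℚᵘ q) ⟨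
  toℚᵘ (fromℚᵘ p) ℚᵘ.+ toℚᵘ (fromℚᵘ q)       ≃⟨ ℚ.toℚᵘ-homo-+ (fromℚᵘ p) (fromℚᵘ q) ⟨
  toℚᵘ (fromℚᵘ p ℚ.+ fromℚᵘ q)               ∎)
  where open ℚᵘ.≤-Reasoning

fromℚᵘ-homo-* : ∀ p q → fromℚᵘ (p ℚᵘ.* q) ≡ fromℚᵘ p ℚ.* fromℚᵘ q
fromℚᵘ-homo-* p q = ℚ.toℚᵘ-injective (begin-equality
  toℚᵘ (fromℚᵘ (p ℚᵘ.* q))                   ≃⟨ ℚ.toℚᵘ-fromℚᵘ (p ℚᵘ.* q) ⟩
  p ℚᵘ.* q                                   ≃⟨ ℚᵘ.*-cong (ℚ.toℚᵘ-fromℚᵘ p) (ℚ.toℚᵘ-fromℚᵘ q) ⟨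
  toℚᵘ (fromℚᵘ p) ℚᵘ.* toℚᵘ (fromℚᵘ q)       ≃⟨ ℚ.toℚᵘ-homo-* (fromℚᵘ p) (fromℚᵘ q) ⟨
  toℚᵘ (fromℚᵘ p ℚ.* fromℚᵘ q)               ∎)
  where open ℚᵘ.≤-Reasoning

fromℕ : ℕ → ℚ
fromℕ n = ℤ.+ n ℚ./ 1

fromℕ-+ : ∀ a b → fromℕ (a + b) ≡ fromℕ a ℚ.+ fromℕ b
fromℕ-+ a b = trans
  (ℚ.fromℚᵘ-cong {mkℚᵘ (ℤ.+ (a + b)) 0} {mkℚᵘ (ℤ.+ a) 0 ℚᵘ.+ mkℚᵘ (ℤ.+ b) 0}
    (*≡* (cong (ℤ._* ℤ.1ℤ)
      (sym (cong₂ ℤ._+_ (ℤ.*-identityʳ (ℤ.+ a)) (ℤ.*-identityʳ (ℤ.+ b)))))))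
  (fromℚᵘ-homo-+ (mkℚᵘ (ℤ.+ a) 0) (mkℚᵘ (ℤ.+ b) 0))

fromℕ-* : ∀ a b → fromℕ (a * b) ≡ fromℕ a ℚ.* fromℕ b
fromℕ-* a b = trans
  (ℚ.fromℚᵘ-cong {mkℚᵘ (ℤ.+ (a * b)) 0} {mkℚᵘ (ℤ.+ a) 0 ℚᵘ.* mkℚᵘ (ℤ.+ b) 0}
    (*≡* (cong (ℤ._* ℤ.1ℤ) (ℤ.pos-* a b))))
  (fromℚᵘ-homo-* (mkℚᵘ (ℤ.+ a) 0) (mkℚᵘ (ℤ.+ b) 0))

a/b*b≡a : ∀ a b .(b≢0 : NonZero b) → a / b ⟨ b≢0 ⟩ ℚ.* fromℕ b ≡ fromℕ a
a/b*b≡a a b@(suc b-1) _ = sym (trans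
  (ℚ.fromℚᵘ-cong {mkℚᵘ (ℤ.+ a) 0} {mkℚᵘ (ℤ.+ a) b-1 ℚᵘ.* mkℚᵘ (ℤ.+ b) 0}
    (*≡* (trans (cong (λ n → ℤ.+ a ℤ.* ℤ.+ n) (*-identityʳ b))
                (sym (ℤ.*-identityʳ (ℤ.+ a ℤ.* ℤ.+ b))))))
  (fromℚᵘ-homo-* (mkℚᵘ (ℤ.+ a) b-1) (mkℚᵘ (ℤ.+ b) 0)))

-- Brings the argument back from products to quotients: the positive factor `fromℕ b` is cancelled
-- from two opposite inequalities.
x*b≡a⇒x≡a/b : ∀ {x} a b .(b≢0 : NonZero b) → x ℚ.* fromℕ b ≡ fromℕ a → x ≡ a / b ⟨ b≢0 ⟩
x*b≡a⇒x≡a/b {x} a b b≢0 x*b≡a = ℚ.≤-antisym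
  (ℚ.*-cancelʳ-≤-pos (fromℕ b) {{b>0}} (ℚ.≤-reflexive eq))
  (ℚ.*-cancelʳ-≤-pos (fromℕ b) {{b>0}} (ℚ.≤-reflexive (sym eq)))
  where
  b>0 : ℚ.Positive (fromℕ b)
  b>0 = ℚ.normalize-pos b 1 {{_}} {{b≢0}}
  eq : x ℚ.* fromℕ b ≡ a / b ⟨ b≢0 ⟩ ℚ.* fromℕ b
  eq = trans x*b≡a (sym (a/b*b≡a a b b≢0))

-- Each factor on the left of the three identities has this shape: `d` is the value belonging to c_i
-- and `e` the value after c_i is replaced by c_i + m.
[1+t/d]*d≡e : ∀ {t d e} .(d≢0 : NonZero d) → d + t ≡ e →
              (1ℚ ℚ.+ t / d ⟨ d≢0 ⟩) ℚ.* fromℕ d ≡ fromℕ e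
[1+t/d]*d≡e {t} {d} {e} d≢0 d+t≡e = begin
  (1ℚ ℚ.+ t / d ⟨ d≢0 ⟩) ℚ.* fromℕ d             ≡⟨ ℚ.*-distribʳ-+ (fromℕ d) 1ℚ (t / d ⟨ d≢0 ⟩) ⟩
  1ℚ ℚ.* fromℕ d ℚ.+ t / d ⟨ d≢0 ⟩ ℚ.* fromℕ d   ≡⟨ cong₂ ℚ._+_ (ℚ.*-identityˡ (fromℕ d)) (a/b*b≡a t d d≢0) ⟩
  fromℕ d ℚ.+ fromℕ t                            ≡⟨ fromℕ-+ d t ⟨
  fromℕ (d + t)                                  ≡⟨ cong fromℕ d+t≡e ⟩
  fromℕ e                                        ∎
  where open ≡-Reasoning

-- Ratios `e x` over `d x` multiply; written without division, the induction needs no nonvanishing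
-- of the `d x`.
∏-ratio : ∀ {A : Set} (f : A → ℚ) (d e : A → ℕ) →
          (∀ x → f x ℚ.* fromℕ (d x) ≡ fromℕ (e x)) →
          ∀ xs → ∏ xs f ℚ.* fromℕ (product (map d xs)) ≡ fromℕ (product (map e xs))
∏-ratio f d e ratio []       = refl
∏-ratio f d e ratio (x ∷ xs) = begin
  (f x ℚ.* ∏ xs f) ℚ.* fromℕ (d x * product (map d xs))
    ≡⟨ cong ((f x ℚ.* ∏ xs f) ℚ.*_) (fromℕ-* (d x) (product (map d xs))) ⟩
  (f x ℚ.* ∏ xs f) ℚ.* (fromℕ (d x) ℚ.* fromℕ (product (map d xs)))
    ≡⟨ ℚ-*.interchange (f x) (∏ xs f) (fromℕ (d x)) _ ⟩
  (f x ℚ.* fromℕ (d x)) ℚ.* (∏ xs f ℚ.* fromℕ (product (map d xs)))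
    ≡⟨ cong₂ ℚ._*_ (ratio x) (∏-ratio f d e ratio xs) ⟩
  fromℕ (e x) ℚ.* fromℕ (product (map e xs))
    ≡⟨ fromℕ-* (e x) (product (map e xs)) ⟨
  fromℕ (e x * product (map e xs)) ∎
  where open ≡-Reasoning

-- The first factor turns `N 0` into `N 1`. The map `h` is arbitrary so that the induction can pass
-- to `h ∘ Fin.suc` and `N ∘ suc`; the application takes `h = id`.
∏-telescope : ∀ {A : Set} {n} (h : Fin n → A) (f : A → ℚ) (N : ℕ → ℚ) →
              (∀ i → f (h i) ℚ.* N (toℕ i) ≡ N (suc (toℕ i))) →
              ∏ (tabulate h) f ℚ.* N 0 ≡ N n
∏-telescope {n = zero}  h f N step = ℚ.*-identityˡ (N 0)
∏-telescope {n = suc n} h f N step = begin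
  (f (h Fin.zero) ℚ.* P) ℚ.* N 0  ≡⟨ cong (ℚ._* N 0) (ℚ.*-comm (f (h Fin.zero)) P) ⟩
  (P ℚ.* f (h Fin.zero)) ℚ.* N 0  ≡⟨ ℚ.*-assoc P _ (N 0) ⟩
  P ℚ.* (f (h Fin.zero) ℚ.* N 0)  ≡⟨ cong (P ℚ.*_) (step Fin.zero) ⟩
  P ℚ.* N 1                       ≡⟨ ∏-telescope (h ∘ Fin.suc) f (N ∘ suc) (step ∘ Fin.suc) ⟩
  N (suc n)                       ∎
  where
  open ≡-Reasoning
  P = ∏ (tabulate (h ∘ Fin.suc)) f

-- Sums and products over lists

product-subsetsOfSize-∷ :
  ∀ {A : Set} r (h : List A → ℕ) x xs →
  product (map h (subsetsOfSize (suc r) (x ∷ xs)))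
  ≡ product (map (h ∘ (x ∷_)) (subsetsOfSize r xs)) * product (map h (subsetsOfSize (suc r) xs))
product-subsetsOfSize-∷ r h x xs = begin
  product (map h (map (x ∷_) Js ++ Ks))
    ≡⟨ cong product (map-++ h (map (x ∷_) Js) Ks) ⟩
  product (map h (map (x ∷_) Js) ++ map h Ks)
    ≡⟨ product-++ (map h (map (x ∷_) Js)) (map h Ks) ⟩
  product (map h (map (x ∷_) Js)) * product (map h Ks)
    ≡⟨ cong (λ l → product l * product (map h Ks)) (map-∘ Js) ⟨
  product (map (h ∘ (x ∷_)) Js) * product (map h Ks) ∎
  where
  open ≡-Reasoning
  Js = subsetsOfSize r xs
  Ks = subsetsOfSize (suc r) xs

-- Permuting the list reorders both the enumeration of subsets and the entries of each subset. The
-- first is absorbed by commutativity of the product, the second by the invariance of `h`, which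
-- passes on to `h ∘ (x ∷_)`.
product-subsetsOfSize-↭ :
  ∀ {A : Set} r (h : List A → ℕ) → (∀ {us vs} → us ↭ vs → h us ≡ h vs) →
  ∀ {xs ys} → xs ↭ ys →
  product (map h (subsetsOfSize r xs)) ≡ product (map h (subsetsOfSize r ys))
product-subsetsOfSize-↭ zero    h inv p             = refl
product-subsetsOfSize-↭ (suc r) h inv ↭.refl        = refl
product-subsetsOfSize-↭ (suc r) h inv (↭.trans p q) =
  trans (product-subsetsOfSize-↭ (suc r) h inv p) (product-subsetsOfSize-↭ (suc r) h inv q)
product-subsetsOfSize-↭ (suc r) h inv (prep {xs} {ys} x p) = begin
  Π (suc r) h (x ∷ xs)             ≡⟨ product-subsetsOfSize-∷ r h x xs ⟩
  Π r (h ∘ (x ∷_)) xs * Π (suc r) h xs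
    ≡⟨ cong₂ _*_ (product-subsetsOfSize-↭ r (h ∘ (x ∷_)) (inv ∘ prep x) p)
                 (product-subsetsOfSize-↭ (suc r) h inv p) ⟩
  Π r (h ∘ (x ∷_)) ys * Π (suc r) h ys  ≡⟨ product-subsetsOfSize-∷ r h x ys ⟨
  Π (suc r) h (x ∷ ys)             ∎
  where
  open ≡-Reasoning
  Π : ℕ → (List _ → ℕ) → List _ → ℕ
  Π r h zs = product (map h (subsetsOfSize r zs))
-- No singleton contains both `x` and `y`, so only the two leading factors change places.
product-subsetsOfSize-↭ (suc zero) h inv (swap x y p) = begin
  h [ x ] * (h [ y ] * _)  ≡⟨ cong (λ z → h [ x ] * (h [ y ] * z)) (product-subsetsOfSize-↭ 1 h inv p) ⟩
  h [ x ] * (h [ y ] * _)  ≡⟨ ℕ-*.x∙yz≈y∙xz (h [ x ]) (h [ y ]) _ ⟩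
  h [ y ] * (h [ x ] * _)  ∎
  where
  open ≡-Reasoning
-- The product splits into four: subsets containing both `x` and `y`, only `x`, only `y`, or
-- neither.
product-subsetsOfSize-↭ (suc (suc r)) h inv (swap {xs} {ys} x y p) = begin
  Π (suc (suc r)) h (x ∷ y ∷ xs)       ≡⟨ expand x y xs ⟩
  Πxy xs * Πx xs * (Πy xs * Π₀ xs)
    ≡⟨ cong₂ _*_ (cong₂ _*_ (product-subsetsOfSize-↭ r _ (λ q → inv (prep x (prep y q))) p)
                            (product-subsetsOfSize-↭ (suc r) _ (inv ∘ prep x) p))
                 (cong₂ _*_ (product-subsetsOfSize-↭ (suc r) _ (inv ∘ prep y) p)
                            (product-subsetsOfSize-↭ (suc (suc r)) h inv p)) ⟩
  Πxy ys * Πx ys * (Πy ys * Π₀ ys)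
    -- Only in the subsets with both elements does the order of the entries change.
    ≡⟨ cong (λ l → l * Πx ys * (Πy ys * Π₀ ys))
         (cong product (map-cong (λ J → inv (swap x y ↭.refl)) (subsetsOfSize r ys))) ⟩
  Πyx ys * Πx ys * (Πy ys * Π₀ ys)     ≡⟨ ℕ-*.interchange (Πyx ys) (Πx ys) (Πy ys) (Π₀ ys) ⟩
  Πyx ys * Πy ys * (Πx ys * Π₀ ys)     ≡⟨ expand y x ys ⟨
  Π (suc (suc r)) h (y ∷ x ∷ ys)       ∎
  where
  open ≡-Reasoning
  Π : ℕ → (List _ → ℕ) → List _ → ℕ
  Π r h zs = product (map h (subsetsOfSize r zs))
  Πxy = Π r (λ J → h (x ∷ y ∷ J))
  Πyx = Π r (λ J → h (y ∷ x ∷ J))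
  Πx  = Π (suc r) (h ∘ (x ∷_))
  Πy  = Π (suc r) (h ∘ (y ∷_))
  Π₀  = Π (suc (suc r)) h
  expand : ∀ u v zs → Π (suc (suc r)) h (u ∷ v ∷ zs) ≡
           Π r (λ J → h (u ∷ v ∷ J)) zs * Π (suc r) (h ∘ (u ∷_)) zs * (Π (suc r) (h ∘ (v ∷_)) zs * Π₀ zs)
  expand u v zs = trans (product-subsetsOfSize-∷ (suc r) h u (v ∷ zs))
    (cong₂ _*_ (product-subsetsOfSize-∷ r (h ∘ (u ∷_)) v zs)
               (product-subsetsOfSize-∷ (suc r) h v zs))

powerSum-↭ : ∀ k {xs ys} → xs ↭ ys → powerSum k xs ≡ powerSum k ys
powerSum-↭ k p = sum-↭ (map⁺ (_^ k) p)

∖0-↭ : ∀ {xs ys} → xs ↭ ys → xs ∖0 ↭ ys ∖0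
∖0-↭ = filter-↭ (λ x → ¬? (x ≟ 0))

m+n≢0 : ∀ m n → NonZero m → NonZero (m + n)
m+n≢0 m n m≢0 = >-nonZero (≤-trans (>-nonZero⁻¹ m {{m≢0}}) (m≤m+n m n))

∷-∖0 : ∀ x xs → NonZero x → (x ∷ xs) ∖0 ≡ x ∷ xs ∖0
∷-∖0 x xs x≢0 = filter-accept (λ x → ¬? (x ≟ 0)) (≢-nonZero⁻¹ x {{x≢0}})

product-upTo∖0 : ∀ m → product (upTo m ∖0) ≡ (m ∸ 1) !
product-upTo∖0 zero    = refl
product-upTo∖0 (suc m) = trans
  -- The head 0 of `upTo (suc m)` is dropped by computation; all later entries are successors and
  -- stay.
  (cong product (filter-all (λ x → ¬? (x ≟ 0)) (All.applyUpTo⁺₂ suc m (λ _ ()))))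
  (product-applyUpTo-suc m)
  where
  open ≡-Reasoning
  product-applyUpTo-suc : ∀ n → product (applyUpTo suc n) ≡ n !
  product-applyUpTo-suc zero    = refl
  product-applyUpTo-suc (suc n) = begin
    -- The factorial recursion removes the largest factor, so the list is split at its end.
    product (applyUpTo suc (suc n))                ≡⟨ cong product (applyUpTo-∷ʳ suc n) ⟨
    product (applyUpTo suc n ++ [ suc n ])         ≡⟨ product-++ (applyUpTo suc n) [ suc n ] ⟩
    product (applyUpTo suc n) * (suc n * 1)        ≡⟨ cong₂ _*_ (product-applyUpTo-suc n) (*-identityʳ (suc n)) ⟩
    n ! * suc n                                    ≡⟨ *-comm (n !) (suc n) ⟩
    suc n !                                        ∎

-- The summand c^k is the missing term j = 0, which completes the binomial expansion. That expansion
-- attaches the exponent j to its first argument, hence `m + c` instead of `c + m` in between.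
^+binomialTail : ∀ k c m → c ^ k + binomialTail k c m ≡ (c + m) ^ k
^+binomialTail k c m = begin
  c ^ k + sum (map term (map suc (upTo k)))
    ≡⟨ cong₂ (λ a l → a + sum l) term₀ map-term ⟩
  sum (applyUpTo term (suc k))
    ≡⟨ sum-applyUpTo (suc k) {term} (λ i → sym (binomialTerm≡term i)) ⟩
  binomialExpansion m c k
    ≡⟨ theorem k m c ⟨
  (m + c) Semiring.^ k
    ≡⟨ ^-≡ (m + c) k ⟩
  (m + c) ^ k
    ≡⟨ cong (_^ k) (+-comm m c) ⟩
  (c + m) ^ k ∎
  where
  open ≡-Reasoning
  open Binomial +-*-commutativeSemiring
  module Semiring = RawSemiring (CommutativeSemiring.rawSemiring +-*-commutativeSemiring)

  term : ℕ → ℕ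
  term j = (k C j) * c ^ (k ∸ j) * m ^ j

  ^-≡ : ∀ x n → x Semiring.^ n ≡ x ^ n
  ^-≡ x zero    = refl
  ^-≡ x (suc n) = cong (x *_) (^-≡ x n)

  ×-≡ : ∀ n x → n Semiring.× x ≡ n * x
  ×-≡ zero    x = refl
  ×-≡ (suc n) x = cong (x +_) (×-≡ n x)

  binomialTerm≡term : ∀ i → binomialTerm m c k i ≡ term (toℕ i)
  binomialTerm≡term i = begin
    (k C j) Semiring.× ((m Semiring.^ j) * (c Semiring.^ (k ∸ j)))
      ≡⟨ ×-≡ (k C j) _ ⟩
    (k C j) * ((m Semiring.^ j) * (c Semiring.^ (k ∸ j)))
      ≡⟨ cong₂ (λ a b → (k C j) * (a * b)) (^-≡ m j) (^-≡ c (k ∸ j)) ⟩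
    (k C j) * (m ^ j * c ^ (k ∸ j))
      ≡⟨ cong ((k C j) *_) (*-comm (m ^ j) (c ^ (k ∸ j))) ⟩
    (k C j) * (c ^ (k ∸ j) * m ^ j)
      ≡⟨ *-assoc (k C j) (c ^ (k ∸ j)) (m ^ j) ⟨
    term j ∎
    where j = toℕ i

  sum-applyUpTo : ∀ n {f : ℕ → ℕ} {v : Fin n → ℕ} → (∀ i → f (toℕ i) ≡ v i) →
                  sum (applyUpTo f n) ≡ Semiring.sum v
  sum-applyUpTo zero    f≡v = refl
  sum-applyUpTo (suc n) f≡v = cong₂ _+_ (f≡v Fin.zero) (sum-applyUpTo n (f≡v ∘ Fin.suc))

  term₀ : c ^ k ≡ term 0
  term₀ = sym (trans (*-identityʳ _) (*-identityˡ (c ^ k)))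

  map-term : map term (map suc (upTo k)) ≡ applyUpTo (term ∘ suc) k
  map-term = trans (cong (map term) (map-upTo suc k)) (map-applyUpTo suc term k)

-- Apéry sets

-- Without repetitions an element occurs at most once in each list, so equality as sets is equality
-- as bags. Comparing Apéry sets thus reduces to comparing membership.
unique-≐⇒↭ : ∀ {A : Set} {xs ys : List A} → Unique xs → Unique ys →
             (∀ {x} → x ∈ xs ⇔ x ∈ ys) → xs ↭ ys
unique-≐⇒↭ xs! ys! xs≐ys = ∼bag⇒↭ (unique∧set⇒bag xs! ys! xs≐ys)

apéry-unique : ∀ S m → Unique (apéry S m)
apéry-unique S m = Unique.filter⁺ (isApéry? S m) (Unique.upTo⁺ _)

-- The search range in `apéry` depends on the stored list of gaps, not only on the elements of the
-- semigroup. This allows `truncation g n` to be exchanged for `S`.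
apéry-cong : ∀ S S′ m → (∀ {x} → x ∈ₛ S ⇔ x ∈ₛ S′) → apéry S m ↭ apéry S′ m
apéry-cong S S′ m S≐S′ = unique-≐⇒↭ (apéry-unique S m) (apéry-unique S′ m)
  (mk⇔ (λ x∈ → from (∈-apéry S′ m _) (transport S S′ (to S≐S′) (from S≐S′) (to (∈-apéry S m _) x∈)))
       (λ x∈ → from (∈-apéry S m _) (transport S′ S (from S≐S′) (to S≐S′) (to (∈-apéry S′ m _) x∈))))
  where
  transport : ∀ S S′ → (∀ {x} → x ∈ₛ S → x ∈ₛ S′) → (∀ {x} → x ∈ₛ S′ → x ∈ₛ S) →
              ∀ {x} → IsApéry S m x → IsApéry S′ m x
  transport S S′ S⊆S′ S′⊆S (x∈S , x-m∉S) = S⊆S′ x∈S , λ (m≤x , x-m∈S′) → x-m∉S (m≤x , S′⊆S x-m∈S′)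

-- The chain from S_0 to S_n and its Apéry sets.

module _ (S : NumericalSemigroup) {n} {c : Fin n → ℕ} (g : IsGapSequence S c) where

  -- Membership in S_0 is vacuous, so x - m is in S_0 as soon as m ≤ x; exactly the x < m remain.
  apéry-truncation-0 : ∀ m → apéry (truncation g 0) m ↭ upTo m
  apéry-truncation-0 m = unique-≐⇒↭ (apéry-unique (truncation g 0) m) (Unique.upTo⁺ m)
    (mk⇔ (λ x∈ → ∈-upTo⁺ (≰⇒> λ m≤x → proj₂ (to (∈-apéry (truncation g 0) m _) x∈) (m≤x , λ _ ())))
         (λ x∈ → from (∈-apéry (truncation g 0) m _) ((λ _ ()) , λ (m≤x , _) → <⇒≱ (∈-upTo⁻ x∈) m≤x)))

  truncation-n : ∀ {x} → x ∈ₛ truncation g n ⇔ x ∈ₛ S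
  truncation-n {x} = mk⇔ truncation⊆S (λ x∈S j _ x≡cj → gap g j (subst (Mem S) x≡cj x∈S))
    where
    truncation⊆S : x ∈ₛ truncation g n → x ∈ₛ S
    truncation⊆S x∈ with mem? S x
    ... | yes x∈S = x∈S
    ... | no  x∉S with exhaustive g x∉S
    ...   | j , cj≡x = contradiction (sym cj≡x) (x∈ j (Fin.toℕ<n j))

  truncation-antitone : ∀ {i x} → x ∈ₛ truncation g (suc i) → x ∈ₛ truncation g i
  truncation-antitone x∈ j j<i = x∈ j (m<n⇒m<1+n j<i)

  truncation-suc : ∀ i {x} → x ∈ₛ truncation g (toℕ i) → x ≢ c i → x ∈ₛ truncation g (suc (toℕ i))
  truncation-suc i x∈ x≢ci j j<1+i with m≤n⇒m<n∨m≡n (s≤s⁻¹ j<1+i)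
  ... | inj₁ j<i = x∈ j j<i
  ... | inj₂ j≡i = subst (λ l → _ ≢ c l) (sym (Fin.toℕ-injective j≡i)) x≢ci

  c∈truncation : ∀ i → c i ∈ₛ truncation g (toℕ i)
  c∈truncation i j j<i ci≡cj = <⇒≢ (increasing g j<i) (sym ci≡cj)

  c∉truncation : ∀ i → c i ∉ₛ truncation g (suc (toℕ i))
  c∉truncation i ci∈ = ci∈ i (n<1+n (toℕ i)) refl

  c-increasing-≤ : ∀ {i j} → toℕ j ≤ toℕ i → c j ≤ c i
  c-increasing-≤ j≤i with m≤n⇒m<n∨m≡n j≤i
  ... | inj₁ j<i = <⇒≤ (increasing g j<i)
  ... | inj₂ j≡i = ≤-reflexive (cong c (Fin.toℕ-injective j≡i))

  -- A gap below c_i is an earlier c_j, which S_{i-1} already omits.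
  truncation-below : ∀ i {x} → x ∈ₛ truncation g (toℕ i) → x < c i → x ∈ₛ S
  truncation-below i {x} x∈ x<ci with mem? S x
  ... | yes x∈S = x∈S
  ... | no  x∉S with exhaustive g x∉S
  ...   | j , refl = contradiction refl (x∈ j (≰⇒> (λ i≤j → <⇒≱ x<ci (c-increasing-≤ i≤j))))

  module _ {m} (m∈S : m ∈ₛ S) (m≢0 : m ≢ 0) (i : Fin n) where

    private
      S₋ = truncation g (toℕ i)
      S₊ = truncation g (suc (toℕ i))
      ≢ci+m? = λ x → ¬? (x ≟ c i + m)

    ∈-T : ∀ {x} → x ∈ T g m i ⇔ (IsApéry S₊ m x × x ≢ c i + m)
    ∈-T = mk⇔ (λ x∈ → let x∈A , x≢ = ∈-filter⁻ ≢ci+m? {xs = apéry S₊ m} x∈ in to (∈-apéry S₊ m _) x∈A , x≢)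
              (λ (x∈A , x≢) → ∈-filter⁺ ≢ci+m? (from (∈-apéry S₊ m _) x∈A) x≢)

    T-unique : Unique (T g m i)
    T-unique = Unique.filter⁺ ≢ci+m? (apéry-unique S₊ m)

    -- `T` is defined from S_i, so this gives its second description, from S_{i-1}. The two
    -- semigroups differ only in c_i, hence the Apéry conditions can differ only at x = c_i and at x
    -- = c_i + m.
    apéry-before : apéry S₋ m ↭ c i ∷ T g m i
    apéry-before = unique-≐⇒↭ (apéry-unique S₋ m) (All.tabulate ci≢ ∷ T-unique)
      (mk⇔ (λ x∈ → forth (to (∈-apéry S₋ m _) x∈)) (λ x∈ → from (∈-apéry S₋ m _) (back x∈)))
      where
      ci≢ : ∀ {x} → x ∈ T g m i → c i ≢ x
      ci≢ x∈T refl = c∉truncation i (proj₁ (proj₁ (to ∈-T x∈T)))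

      forth : ∀ {x} → IsApéry S₋ m x → x ∈ c i ∷ T g m i
      forth {x} (x∈ , x-m∉) with x ≟ c i
      ... | yes x≡ci = here x≡ci
      ... | no  x≢ci = there (from ∈-T
        ( (truncation-suc i x∈ x≢ci , λ (m≤x , x-m∈) → x-m∉ (m≤x , truncation-antitone x-m∈))
        -- The element c_i + m is not Apéry for S_{i-1}, because subtracting m gives c_i, which
        -- S_{i-1} still contains.
        , λ x≡ → x-m∉ (subst (m ≤_) (sym x≡) (m≤n+m m (c i))
                      , subst (_∈ₛ S₋) (sym (trans (cong (_∸ m) x≡) (m+n∸n≡m (c i) m))) (c∈truncation i))))

      back : ∀ {x} → x ∈ c i ∷ T g m i → IsApéry S₋ m x
      -- An element c_i − m of S_{i-1} would lie below c_i, hence in S, which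
      -- would put c_i into S.
      back (here refl) = c∈truncation i , λ (m≤ci , ci-m∈) →
        gap g i (subst (_∈ₛ S) (m∸n+n≡m m≤ci)
          (+-closed S (truncation-below i ci-m∈ (∸-monoʳ-< (n≢0⇒n>0 m≢0) m≤ci)) m∈S))
      back (there x∈T) with to ∈-T x∈T
      -- Since x is not c_i + m, the element x - m is not c_i and would survive into S_i.
      ... | (x∈ , x-m∉) , x≢ = truncation-antitone x∈ , λ (m≤x , x-m∈) →
        x-m∉ (m≤x , truncation-suc i x-m∈ (λ x-m≡ci → x≢ (trans (sym (m∸n+n≡m m≤x)) (cong (_+ m) x-m≡ci))))

    apéry-after : apéry S₊ m ↭ c i + m ∷ T g m i
    apéry-after = unique-≐⇒↭ (apéry-unique S₊ m)
      (All.tabulate (λ x∈T ci+m≡x → proj₂ (to ∈-T x∈T) (sym ci+m≡x)) ∷ T-unique)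
      (mk⇔ forth back)
      where
      forth : ∀ {x} → x ∈ apéry S₊ m → x ∈ c i + m ∷ T g m i
      forth {x} x∈ with x ≟ c i + m
      ... | yes x≡ = here x≡
      ... | no  x≢ = there (∈-filter⁺ ≢ci+m? x∈ x≢)

      back : ∀ {x} → x ∈ c i + m ∷ T g m i → x ∈ apéry S₊ m
      back (here refl) = from (∈-apéry S₊ m _)
        -- The sum c_i + m exceeds all of c_1, ..., c_i and so lies in S_i, while c_i does not.
        ( (λ j j<1+i ci+m≡cj → <⇒≢ (≤-<-trans (c-increasing-≤ (s≤s⁻¹ j<1+i)) (m<m+n (c i) (n≢0⇒n>0 m≢0))) (sym ci+m≡cj))
        , λ (_ , ci∈) → c∉truncation i (subst (_∈ₛ S₊) (m+n∸n≡m (c i) m) ci∈))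
      back (there x∈T) = proj₁ (∈-filter⁻ ≢ci+m? {xs = apéry S₊ m} x∈T)

  -- Permutation invariance makes `F` a function of finite sets. The denominator `b` is separate
  -- from `F (upTo m)` so that (m - 1)! can enter in its own form.
  apéry-telescope :
    ∀ {m} → m ∈ₛ S → m ≢ 0 → (F : List ℕ → ℕ) → (∀ {xs ys} → xs ↭ ys → F xs ≡ F ys) →
    (f : Fin n → ℚ) →
    (∀ i → f i ℚ.* fromℕ (F (c i ∷ T g m i)) ≡ fromℕ (F (c i + m ∷ T g m i))) →
    ∀ b .(b≢0 : NonZero b) → F (upTo m) ≡ b →
    ∏ (allFin n) f ≡ F (apéry S m) / b ⟨ b≢0 ⟩
  apéry-telescope {m} m∈S m≢0 F F-↭ f ratio b b≢0 F[upTo]≡b = x*b≡a⇒x≡a/b (F (apéry S m)) b b≢0 (begin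
    ∏ (allFin n) f ℚ.* fromℕ b
      ≡⟨ cong (λ N → ∏ (allFin n) f ℚ.* fromℕ N) F[upTo]≡b ⟨
    ∏ (allFin n) f ℚ.* fromℕ (F (upTo m))
      ≡⟨ cong (λ N → ∏ (allFin n) f ℚ.* fromℕ N) (F-↭ (apéry-truncation-0 m)) ⟨
    ∏ (allFin n) f ℚ.* N 0
      ≡⟨ ∏-telescope id f N step ⟩
    N n
      ≡⟨ cong fromℕ (F-↭ (apéry-cong (truncation g n) S m truncation-n)) ⟩
    fromℕ (F (apéry S m)) ∎)
    where
    open ≡-Reasoning
    N : ℕ → ℚ
    N i = fromℕ (F (apéry (truncation g i) m))
    step : ∀ i → f i ℚ.* N (toℕ i) ≡ N (suc (toℕ i))
    step i = begin
      f i ℚ.* N (toℕ i)                       ≡⟨ cong (λ N → f i ℚ.* fromℕ N) (F-↭ (apéry-before m∈S m≢0 i)) ⟩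
      f i ℚ.* fromℕ (F (c i ∷ T g m i))       ≡⟨ ratio i ⟩
      fromℕ (F (c i + m ∷ T g m i))           ≡⟨ cong fromℕ (F-↭ (apéry-after m∈S m≢0 i)) ⟨
      N (suc (toℕ i))                         ∎

-- Ratios produced by replacing c with c + m.

powerSum-shift : ∀ k c m J → powerSum k J + c ^ k + binomialTail k c m ≡ powerSum k (c + m ∷ J)
powerSum-shift k c m J = begin
  powerSum k J + c ^ k + binomialTail k c m    ≡⟨ +-assoc (powerSum k J) (c ^ k) _ ⟩
  powerSum k J + (c ^ k + binomialTail k c m)  ≡⟨ cong (powerSum k J +_) (^+binomialTail k c m) ⟩
  powerSum k J + (c + m) ^ k                   ≡⟨ +-comm (powerSum k J) _ ⟩
  powerSum k (c + m ∷ J)                       ∎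
  where open ≡-Reasoning

powerSum-ratio : ∀ k c m J (c≢0 : NonZero c) →
  (1ℚ ℚ.+ binomialTail k c m / (powerSum k J + c ^ k) ⟨ powerSum+^≢0 k J c c≢0 ⟩)
    ℚ.* fromℕ (powerSum k (c ∷ J)) ≡ fromℕ (powerSum k (c + m ∷ J))
powerSum-ratio k c m J c≢0 = trans
  -- `powerSum` of `c ∷ J` starts with c^k, whereas the denominator ends with it.
  (cong (λ d → (1ℚ ℚ.+ binomialTail k c m / (powerSum k J + c ^ k) ⟨ powerSum+^≢0 k J c c≢0 ⟩) ℚ.* fromℕ d)
    (+-comm (c ^ k) (powerSum k J)))
  ([1+t/d]*d≡e (powerSum+^≢0 k J c c≢0) (powerSum-shift k c m J))

-- Carries along the factor `c` that the exchange leaves unchanged.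
ratio-*ʳ : ∀ x a b c → x ℚ.* fromℕ b ≡ fromℕ a → x ℚ.* fromℕ (b * c) ≡ fromℕ (a * c)
ratio-*ʳ x a b c x*b≡a = begin
  x ℚ.* fromℕ (b * c)              ≡⟨ cong (x ℚ.*_) (fromℕ-* b c) ⟩
  x ℚ.* (fromℕ b ℚ.* fromℕ c)      ≡⟨ ℚ.*-assoc x (fromℕ b) (fromℕ c) ⟨
  x ℚ.* fromℕ b ℚ.* fromℕ c        ≡⟨ cong (ℚ._* fromℕ c) x*b≡a ⟩
  fromℕ a ℚ.* fromℕ c              ≡⟨ fromℕ-* a c ⟨
  fromℕ (a * c)                    ∎
  where open ≡-Reasoning

-- Subsets of size r + 1 containing c correspond to sets `J` of size r, which explains the p - 1 in
-- the theorem. Subsets avoiding c contribute the same factor before and after.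
subsetPowerProduct-ratio : ∀ k r c m xs (c≢0 : NonZero c) →
  let Π = λ ys → product (map (powerSum k) (subsetsOfSize (suc r) (ys ∖0))) in
  (∏[ J ∈ subsetsOfSize r (xs ∖0) ]
     (1ℚ ℚ.+ binomialTail k c m / (powerSum k J + c ^ k) ⟨ powerSum+^≢0 k J c c≢0 ⟩))
    ℚ.* fromℕ (Π (c ∷ xs)) ≡ fromℕ (Π (c + m ∷ xs))
subsetPowerProduct-ratio k r c m xs c≢0 = begin
  f ℚ.* fromℕ (Π ((c ∷ xs) ∖0))
    ≡⟨ cong (λ N → f ℚ.* fromℕ N) (expand c c≢0) ⟩
  f ℚ.* fromℕ (product (map (powerSum k ∘ (c ∷_)) Js) * Π (xs ∖0))
    ≡⟨ ratio-*ʳ f (product (map (powerSum k ∘ (c + m ∷_)) Js)) (product (map (powerSum k ∘ (c ∷_)) Js)) (Π (xs ∖0))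
         (∏-ratio factor (powerSum k ∘ (c ∷_)) (powerSum k ∘ (c + m ∷_)) (λ J → powerSum-ratio k c m J c≢0) Js) ⟩
  fromℕ (product (map (powerSum k ∘ (c + m ∷_)) Js) * Π (xs ∖0))
    ≡⟨ cong fromℕ (expand (c + m) (m+n≢0 c m c≢0)) ⟨
  fromℕ (Π ((c + m ∷ xs) ∖0)) ∎
  where
  open ≡-Reasoning
  Js = subsetsOfSize r (xs ∖0)
  Π : List ℕ → ℕ
  Π ys = product (map (powerSum k) (subsetsOfSize (suc r) ys))
  factor : List ℕ → ℚ
  factor J = 1ℚ ℚ.+ binomialTail k c m / (powerSum k J + c ^ k) ⟨ powerSum+^≢0 k J c c≢0 ⟩
  f = ∏ Js factor
  expand : ∀ x → NonZero x →
           Π ((x ∷ xs) ∖0) ≡ product (map (powerSum k ∘ (x ∷_)) Js) * Π (xs ∖0)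
  expand x x≢0 = trans (cong Π (∷-∖0 x xs x≢0)) (product-subsetsOfSize-∷ r (powerSum k) x (xs ∖0))

product-ratio : ∀ c m xs (c≢0 : NonZero c) →
  (1ℚ ℚ.+ m / c ⟨ c≢0 ⟩) ℚ.* fromℕ (product ((c ∷ xs) ∖0)) ≡ fromℕ (product ((c + m ∷ xs) ∖0))
product-ratio c m xs c≢0 = begin
  f ℚ.* fromℕ (product ((c ∷ xs) ∖0))      ≡⟨ cong (λ l → f ℚ.* fromℕ (product l)) (∷-∖0 c xs c≢0) ⟩
  f ℚ.* fromℕ (c * product (xs ∖0))        ≡⟨ ratio-*ʳ f (c + m) c (product (xs ∖0)) ([1+t/d]*d≡e {m} c≢0 refl) ⟩
  fromℕ ((c + m) * product (xs ∖0))        ≡⟨ cong (fromℕ ∘ product) (∷-∖0 (c + m) xs (m+n≢0 c m c≢0)) ⟨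
  fromℕ (product ((c + m ∷ xs) ∖0))        ∎
  where
  open ≡-Reasoning
  f = 1ℚ ℚ.+ m / c ⟨ c≢0 ⟩

mainTheorem6 : (S : NumericalSemigroup) (S≢ℕ : ¬ (∀ x → x ∈ₛ S))
    (m : ℕ) (m∈S : m ∈ₛ S) (m≢0 : m ≢ 0)
    {n : ℕ} (c : Fin n → ℕ) (g : IsGapSequence S c) →
    ((k p : ℕ) → 1 ≤ k → (1≤p : 1 ≤ p) → p < m →
    (∏[ i ∈ allFin n ] ∏[ J ∈ subsetsOfSize (p ∸ 1) (T g m i ∖0) ]
    (1ℚ ℚ.+ binomialTail k (c i) m / (powerSum k J + c i ^ k) ⟨ powerSum+^≢0 k J (c i) (gap≢0 g i) ⟩))
    ≡ product (map (powerSum k) (subsetsOfSize p (apéry S m ∖0)))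
    / product (map (powerSum k) (subsetsOfSize p (upTo m ∖0))) ⟨ ∏powerSum≢0 k (upTo m) 1≤p ⟩)
    × ((k : ℕ) → 1 ≤ k →
    (∏[ i ∈ allFin n ]
    (1ℚ ℚ.+ binomialTail k (c i) m / (powerSum k (T g m i) + c i ^ k) ⟨ powerSum+^≢0 k (T g m i) (c i) (gap≢0 g i) ⟩))
    ≡ powerSum k (apéry S m) / powerSum k (upTo m) ⟨ powerSum-upTo≢0 k (proper⇒2≤m S S≢ℕ m∈S m≢0) ⟩)
    × ((∏[ i ∈ allFin n ] (1ℚ ℚ.+ m / c i ⟨ gap≢0 g i ⟩))
    ≡ product (apéry S m ∖0) / ((m ∸ 1) !) ⟨ (m ∸ 1) !≢0 ⟩)
mainTheorem6 S S≢ℕ m m∈S m≢0 c g = subsetIdentity , powerSumIdentity , productIdentity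
  where
  subsetIdentity : (k p : ℕ) → 1 ≤ k → (1≤p : 1 ≤ p) → p < m → _
  -- Writing p as `suc r` lets `p ∸ 1` compute to `r`.
  subsetIdentity k (suc r) _ 1≤p _ =
    apéry-telescope S g m∈S m≢0 (λ xs → product (map (powerSum k) (subsetsOfSize (suc r) (xs ∖0))))
      (λ xs↭ys → product-subsetsOfSize-↭ (suc r) (powerSum k) (powerSum-↭ k) (∖0-↭ xs↭ys)) _
      (λ i → subsetPowerProduct-ratio k r (c i) m (T g m i) (gap≢0 g i))
      _ (∏powerSum≢0 k (upTo m) 1≤p) refl

  powerSumIdentity : (k : ℕ) → 1 ≤ k → _
  powerSumIdentity k _ =
    apéry-telescope S g m∈S m≢0 (powerSum k) (powerSum-↭ k) _
      (λ i → powerSum-ratio k (c i) m (T g m i) (gap≢0 g i))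
      _ (powerSum-upTo≢0 k (proper⇒2≤m S S≢ℕ m∈S m≢0)) refl

  productIdentity : _
  productIdentity =
    apéry-telescope S g m∈S m≢0 (λ xs → product (xs ∖0)) (λ xs↭ys → product-↭ (∖0-↭ xs↭ys)) _
      (λ i → product-ratio (c i) m (T g m i) (gap≢0 g i))
      -- Here alone the denominator is not literally `F (upTo m)` and has to be evaluated.
      ((m ∸ 1) !) ((m ∸ 1) !≢0) (product-upTo∖0 m)
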